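{- Let $\mathcal{M}$ and $\mathcal{M}'$ be Kripke models with worlds $s$ of $\mathcal{M}$ and $s'$ of $\mathcal{M}'$ such that $(\mathcal{M},s)\rightleftharpoons(\mathcal{M}',s')$. Then for every formula $\psi\in\mathcal{L}_{glal}$, $$(\mathcal{M},s)\models\psi \iff (\mathcal{M}',s')\models\psi.$$ In particular, if $\psi=[\theta]^-_A\theta'$ (respectively $\psi=[\theta]^+_A\theta'$), then $\mathcal{M}^-_{(s,\theta,A)}\rightleftharpoons\mathcal{M}'^-_{(s',\theta,A)}$ (respectively $\mathcal{M}^+_{(s,\theta,A)}\rightleftharpoons\mathcal{M}'^+_{(s',\theta,A)}$).
   Context: Language. $AP$ is a set of atoms and $Ag$ a finite set of agents. The formulas of $\mathcal{L}_{glal}$ are given, for $p\in AP$ and $A\subseteq Ag$, by $\psi ::= p \mid \neg\psi \mid \psi\land\psi \mid C_A\psi \mid [\psi]^+_A\psi \mid [\psi]^-_A\psi$. Models. A (Kripke) model is $\mathcal{M}=\langle W,\{R_a\}_{a\in Ag},V\rangle$ with $W$ a set of worlds, each $R_a$ an equivalence relation on $W$, and $V:AP\to 2^W$. For $w\in W$, $R_a(w)=\{w' : R_a(w,w')\}$; for $A\subseteq Ag$, $R^C_A=(\bigcup_{a\in A}R_a)^*$ is the reflexive-transitive closure and $R^C_A(w)=\{w' : R^C_A(w,w')\}$. Semantics. The satisfaction set $[\![\varphi]\!]_{\mathcal{M}}\subseteq W$ is defined by: $[\![p]\!]_{\mathcal{M}}=V(p)$; $[\![\neg\psi]\!]_{\mathcal{M}}=W\setminus[\![\psi]\!]_{\mathcal{M}}$;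 $[\![\psi\land\psi']\!]_{\mathcal{M}}=[\![\psi]\!]_{\mathcal{M}}\cap[\![\psi']\!]_{\mathcal{M}}$; $[\![C_A\psi]\!]_{\mathcal{M}}=\{w : R^C_A(w)\subseteq[\![\psi]\!]_{\mathcal{M}}\}$; and for $\star\in\{+,-\}$, $[\![[\psi]^\star_A\psi']\!]_{\mathcal{M}}=\{w : \text{if } w\in[\![\psi]\!]_{\mathcal{M}} \text{ then } w\in[\![\psi']\!]_{\mathcal{M}^\star_{(w,\psi,A)}}\}$. The refinements $\mathcal{M}^-_{(w,\psi,A)}$ and $\mathcal{M}^+_{(w,\psi,A)}$ have the same worlds and valuation as $\mathcal{M}$ and relations $R^-_b=R^+_b=R_b$ for $b\notin A$, while for $a\in A$: $R^-_a(v)=R_a(v)\cap[\![\psi]\!]_{\mathcal{M}}$ if $v\in R_a(w)\cap[\![\psi]\!]_{\mathcal{M}}$; $R^-_a(v)=R_a(v)\cap[\![\neg\psi]\!]_{\mathcal{M}}$ if $v\in R_a(w)\cap[\![\neg\psi]\!]_{\mathcal{M}}$; $R^-_a(v)=R_a(v)$ otherwise; and $R^+_a(v)$ is defined by the same three cases with $R_a(w)$ replaced by $R^C_A(w)$ in the case conditions. We write $(\mathcal{M},w)\models\varphi$ for $w\in[\![\varphi]\!]_{\mathcal{M}}$. $\pm$-bisimulation. For $A\subseteq Ag$ (possibly empty), write $R_A(w,v)$ if for every $a\in Ag$: $R_a(w,v)$ iff $a\in A$ (i.e. $A$ is exactly the set of agents relating $w$ and $v$). Given models $\mathcal{M}=\langle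 W,\{R_a\},V\rangle$ and $\mathcal{M}'=\langle W',\{R'_a\},V'\rangle$, a $\pm$-simulation is a relation $\mathbf{S}\subseteq W\times W'$ such that $\mathbf{S}(w,w')$ implies: (Atoms) $w\in V(p)$ iff $w'\in V'(p)$ for every $p\in AP$; (Forth) for every $A\subseteq Ag$ and $v\in W$, if $R_A(w,v)$ then for some $v'\in W'$, $R'_A(w',v')$ and $\mathbf{S}(v,v')$; (Reach) if $\mathbf{S}(v,v')$, then for every $a\in Ag$, $R_a(w,v)$ iff $R'_a(w',v')$. A $\pm$-bisimulation is a relation $\mathbf{B}\subseteq W\times W'$ such that both $\mathbf{B}$ and $\mathbf{B}^{ -1}$ are $\pm$-simulations. Worlds $w,w'$ are $\pm$-bisimilar, $w\rightleftharpoons w'$, if $\mathbf{B}(w,w')$ for some $\pm$-bisimulation $\mathbf{B}$. Models are $\pm$-bisimilar, $\mathcal{M}\rightleftharpoons\mathcal{M}'$, if every $w\in W$ is $\pm$-bisimilar to some $w'\in W'$ and every $w'\in W'$ is $\pm$-bisimilar to some $w\in W$. Finally $(\mathcal{M},w)\rightleftharpoons(\mathcal{M}',w')$ means $\mathcal{M}\rightleftharpoons\mathcal{M}'$ and $w\rightleftharpoons w'$. -}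

module Defs where

open import Axiom.ExcludedMiddle using (ExcludedMiddle)
open import Data.Empty using (⊥-elim)
open import Data.Fin.Base using (Fin)
open import Data.Fin.Subset using (Subset; _∈_; _∉_)
open import Data.Fin.Subset.Properties using (_∈?_)
open import Data.Nat.Base using (ℕ)
open import Data.Product.Base using (Σ; ∃; _×_; _,_; proj₁; proj₂)
open import Function.Base using (flip)
open import Function.Bundles using (_⇔_; mk⇔; Equivalence)
open import Level using (Level; suc)
open import Relation.Binary.Core using (Rel; REL)
open import Relation.Binary.Structures using (IsEquivalence)
open import Relation.Binary.Construct.Closure.ReflexiveTransitive using (Star; ε; _◅_; _◅◅_)
open import Relation.Nullary using (¬_; yes; no)
open import Relation.Unary using (Pred)

private variable
  n  : ℕ
  AP : Set
  ℓ  : Level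

infix  9 ¬′_
infixr 8 _∧′_
infix  4 _,_⊨_ _⇌_ _,_↭_,_ _,_⇌_,_

-- The set Ag of agents is Fin n.
data Formula (n : ℕ) (AP : Set) : Set where
  atom    : AP → Formula n AP
  ¬′_     : Formula n AP → Formula n AP
  _∧′_    : Formula n AP → Formula n AP → Formula n AP
  C       : Subset n → Formula n AP → Formula n AP
  [_]⁺_·_ : Formula n AP → Subset n → Formula n AP → Formula n AP
  [_]⁻_·_ : Formula n AP → Subset n → Formula n AP → Formula n AP

-- A Kripke model is a Structure satisfying IsModel. The two are separated
-- because the refinement of a model is again a model only classically (see
-- ⁻-isModel and ⁺-isModel), whereas the semantics makes sense on any structure.
record Structure (n : ℕ) (AP : Set) (ℓ : Level) : Set (suc ℓ) where
  field
    W : Set ℓ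
    R : Fin n → Rel W ℓ
    V : AP → Pred W ℓ

  Rᶜ : Subset n → Rel W ℓ
  Rᶜ A = Star (λ w v → ∃ λ a → a ∈ A × R a w v)

open Structure public

IsModel : Structure n AP ℓ → Set ℓ
IsModel M = ∀ a → IsEquivalence (R M a)

-- Definition by cases, each case read as an implication, so that nothing has
-- to be decided. Z a is the set appearing in the case conditions (R_a(w) or
-- R^C_A(w)) and P is the set of worlds satisfying the announced formula.
record RefinedR (M : Structure n AP ℓ) (A : Subset n)
                (Z : Fin n → Pred (W M) ℓ) (P : Pred (W M) ℓ)
                (a : Fin n) (v u : W M) : Set ℓ where
  field
    outside   : a ∉ A → R M a v u
    positive  : a ∈ A → Z a v × P v → R M a v u × P u
    negative  : a ∈ A → Z a v × ¬ P v → R M a v u × ¬ P u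
    otherwise : a ∈ A → ¬ (Z a v × P v) → ¬ (Z a v × ¬ P v) → R M a v u

refine : (M : Structure n AP ℓ) → Subset n →
         (Fin n → Pred (W M) ℓ) → Pred (W M) ℓ → Structure n AP ℓ
refine M A Z P = record { W = W M ; R = RefinedR M A Z P ; V = V M }

refine⁻ refine⁺ : (M : Structure n AP ℓ) → W M → Pred (W M) ℓ → Subset n →
                  Structure n AP ℓ
refine⁻ M w P A = refine M A (λ a → R M a w) P
refine⁺ M w P A = refine M A (λ _ → Rᶜ M A w) P

⟦_⟧ : Formula n AP → (M : Structure n AP ℓ) → Pred (W M) ℓ
⟦ atom p ⟧         M w = V M p w
⟦ ¬′ ψ ⟧           M w = ¬ ⟦ ψ ⟧ M w
⟦ ψ ∧′ ψ′ ⟧        M w = ⟦ ψ ⟧ M w × ⟦ ψ′ ⟧ M w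
⟦ C A ψ ⟧          M w = ∀ v → Rᶜ M A w v → ⟦ ψ ⟧ M v
⟦ [ ψ ]⁺ A · ψ′ ⟧  M w = ⟦ ψ ⟧ M w → ⟦ ψ′ ⟧ (refine⁺ M w (⟦ ψ ⟧ M) A) w
⟦ [ ψ ]⁻ A · ψ′ ⟧  M w = ⟦ ψ ⟧ M w → ⟦ ψ′ ⟧ (refine⁻ M w (⟦ ψ ⟧ M) A) w

_,_⊨_ : (M : Structure n AP ℓ) → W M → Formula n AP → Set ℓ
M , w ⊨ ψ = ⟦ ψ ⟧ M w

_⁻⟨_,_,_⟩ _⁺⟨_,_,_⟩ : (M : Structure n AP ℓ) → W M → Formula n AP → Subset n →
                      Structure n AP ℓ
M ⁻⟨ w , ψ , A ⟩ = refine⁻ M w (⟦ ψ ⟧ M) A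
M ⁺⟨ w , ψ , A ⟩ = refine⁺ M w (⟦ ψ ⟧ M) A

-- Here sets of agents are predicates, not Boolean vectors: the relations of a
-- model need not be decidable, and the set of agents relating two given
-- worlds must be among the sets quantified over in the forth condition.
Exactly : (M : Structure n AP ℓ) → Pred (Fin n) ℓ → Rel (W M) ℓ
Exactly M A w v = ∀ a → R M a w v ⇔ A a

record Is±Simulation (M M′ : Structure n AP ℓ) (S : REL (W M) (W M′) ℓ) :
                     Set (suc ℓ) where
  field
    atoms : ∀ {w w′} → S w w′ → ∀ p → V M p w ⇔ V M′ p w′
    forth : ∀ {w w′} → S w w′ → ∀ A v → Exactly M A w v →
            ∃ λ v′ → Exactly M′ A w′ v′ × S v v′
    reach : ∀ {w w′} → S w w′ → ∀ {v v′} → S v v′ →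
            ∀ a → R M a w v ⇔ R M′ a w′ v′

Is±Bisimulation : (M M′ : Structure n AP ℓ) → REL (W M) (W M′) ℓ → Set (suc ℓ)
Is±Bisimulation M M′ B = Is±Simulation M M′ B × Is±Simulation M′ M (flip B)

_,_↭_,_ : (M : Structure n AP ℓ) → W M → (M′ : Structure n AP ℓ) → W M′ →
          Set (suc ℓ)
M , w ↭ M′ , w′ = ∃ λ B → Is±Bisimulation M M′ B × B w w′

_⇌_ : (M M′ : Structure n AP ℓ) → Set (suc ℓ)
M ⇌ M′ = (∀ w → ∃ λ w′ → M , w ↭ M′ , w′) × (∀ w′ → ∃ λ w → M , w ↭ M′ , w′)

_,_⇌_,_ : (M : Structure n AP ℓ) → W M → (M′ : Structure n AP ℓ) → W M′ →
          Set (suc ℓ)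
M , w ⇌ M′ , w′ = M ⇌ M′ × M , w ↭ M′ , w′

module _ (em : ExcludedMiddle ℓ) (M : Structure n AP ℓ) (eq : IsModel M)
         (A : Subset n) (Z : Fin n → Pred (W M) ℓ) (P : Pred (W M) ℓ)
         (closed : ∀ {a v u} → a ∈ A → Z a v → R M a v u → Z a u) where

  open RefinedR
  private module E {a} = IsEquivalence (eq a)

  private
    Agree : Fin n → Rel (W M) ℓ
    Agree a v u = R M a v u × (a ∈ A → Z a v → P v ⇔ P u)

    to : ∀ {a v u} → RefinedR M A Z P a v u → Agree a v u
    to {a} {v} r with a ∈? A
    ... | no a∉ = outside r a∉ , λ a∈ → ⊥-elim (a∉ a∈)
    ... | yes a∈ with em {P = Z a v} | em {P = P v}
    ... | no ¬z | _    = otherwise r a∈ (λ x → ¬z (proj₁ x)) (λ x → ¬z (proj₁ x))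
                       , λ _ z → ⊥-elim (¬z z)
    ... | yes z | yes p = let (q , pu) = positive r a∈ (z , p) in
                          q , λ _ _ → mk⇔ (λ _ → pu) (λ _ → p)
    ... | yes z | no ¬p = let (q , ¬pu) = negative r a∈ (z , ¬p) in
                          q , λ _ _ → mk⇔ (λ p → ⊥-elim (¬p p)) (λ p → ⊥-elim (¬pu p))

    from : ∀ {a v u} → Agree a v u → RefinedR M A Z P a v u
    from (r , f) = record
      { outside   = λ _ → r
      ; positive  = λ a∈ (z , p) → r , Equivalence.to (f a∈ z) p
      ; negative  = λ a∈ (z , ¬p) → r , λ p → ¬p (Equivalence.from (f a∈ z) p)
      ; otherwise = λ _ _ _ → r
      }

  refine-isModel : IsModel (refine M A Z P)
  refine-isModel a = record
    { refl  = from (E.refl , λ _ _ → mk⇔ (λ p → p) (λ p → p))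
    ; sym   = λ r → let (q , f) = to r in
        from (E.sym q , λ a∈ z → let e = f a∈ (closed a∈ z (E.sym q)) in
                                 mk⇔ (Equivalence.from e) (Equivalence.to e))
    ; trans = λ r r′ → let (q , f) = to r ; (q′ , f′) = to r′ in
        from (E.trans q q′ , λ a∈ z →
          let e = f a∈ z ; e′ = f′ a∈ (closed a∈ z q) in
          mk⇔ (λ p → Equivalence.to e′ (Equivalence.to e p))
              (λ p → Equivalence.from e (Equivalence.from e′ p)))
    }

⁻-isModel : ExcludedMiddle ℓ → (M : Structure n AP ℓ) → IsModel M →
            ∀ w ψ A → IsModel (M ⁻⟨ w , ψ , A ⟩)
⁻-isModel em M eq w ψ A =
  refine-isModel em M eq A _ _ (λ {a} _ → IsEquivalence.trans (eq a))

⁺-isModel : ExcludedMiddle ℓ → (M : Structure n AP ℓ) → IsModel M →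
            ∀ w ψ A → IsModel (M ⁺⟨ w , ψ , A ⟩)
⁺-isModel em M eq w ψ A =
  refine-isModel em M eq A _ _ (λ {a} a∈ z r → z ◅◅ ((a , a∈ , r) ◅ ε))

{-# OPTIONS --safe #-}
-- The forth condition also quantifies over the sets of agents that relate no
-- worlds at all, so a ±-bisimulation with one related pair is already total
-- and surjective. For total and surjective relations forth follows from reach,
-- and reach transfers to the refined relations because the case conditions are
-- invariant. Truth is then invariant by induction on the formula, carrying the
-- same relation through every refinement. The induction runs over reflexive
-- structures rather than models because refinement preserves reflexivity
-- constructively, but symmetry and transitivity only classically.
module Submission where

open import Defs
open import Data.Fin.Base using (Fin)
open import Data.Fin.Subset using (Subset; _∈_)
open import Data.Nat.Base using (ℕ)
open import Data.Product.Base using (∃; _×_; _,_; proj₂; map)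
open import Function.Base using (flip; id)
open import Function.Bundles using (_⇔_; mk⇔; Equivalence)
open import Function.Construct.Composition using (_⇔-∘_)
open import Function.Construct.Identity using (⇔-id)
open import Function.Construct.Symmetry using (⇔-sym)
open import Level using (Level)
open import Relation.Binary.Construct.Closure.ReflexiveTransitive using (ε; _◅_)
open import Relation.Binary.Core using (REL)
open import Relation.Binary.Definitions using (Reflexive)
open import Relation.Binary.Structures using (IsEquivalence)
open import Relation.Unary using (Pred)

open Equivalence using (to; from)

private variable
  n    : ℕ
  AP   : Set
  ℓ    : Level
  M M′ : Structure n AP ℓ

-- Only `reach` mentions the accessibility relations, so the other three fields pass verbatim to any
-- refinement.
record IsTotalBisimulation (M M′ : Structure n AP ℓ)
                           (B : REL (W M) (W M′) ℓ) : Set ℓ where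
  field
    atoms      : ∀ {w w′} → B w w′ → ∀ p → V M p w ⇔ V M′ p w′
    total      : ∀ w → ∃ λ w′ → B w w′
    surjective : ∀ w′ → ∃ λ w → B w w′
    reach      : ∀ {w w′} → B w w′ → ∀ {v v′} → B v v′ →
                 ∀ a → R M a w v ⇔ R M′ a w′ v′

open IsTotalBisimulation

IsReflexive : Structure n AP ℓ → Set ℓ
IsReflexive M = ∀ a → Reflexive (R M a)

isTotalBisimulation-sym : ∀ {B} → IsTotalBisimulation M M′ B →
                          IsTotalBisimulation M′ M (flip B)
isTotalBisimulation-sym b = record
  { atoms      = λ r p → ⇔-sym (atoms b r p)
  ; total      = surjective b
  ; surjective = total b
  ; reach      = λ r q a → ⇔-sym (reach b r q a)
  }

±simulation⇒total : ∀ {S} → Is±Simulation M M′ S →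
                    ∀ {w w′} → S w w′ → ∀ v → ∃ λ v′ → S v v′
±simulation⇒total {M = M} sim {w} r v =
  -- The set of agents is chosen as the one relating `w` and `v`, so `Exactly` holds trivially for
  -- an arbitrary `v`.
  map id proj₂ (Is±Simulation.forth sim r (λ a → R M a w v) v (λ a → ⇔-id _))

±bisimulation⇒total : ∀ {B} → Is±Bisimulation M M′ B → ∀ {w w′} → B w w′ →
                      IsTotalBisimulation M M′ B
±bisimulation⇒total (sim , sim⁻¹) r = record
  { atoms      = Is±Simulation.atoms sim
  ; total      = ±simulation⇒total sim r
  ; surjective = ±simulation⇒total sim⁻¹ r
  ; reach      = Is±Simulation.reach sim
  }

total⇒±simulation : ∀ {B} → IsTotalBisimulation M M′ B → Is±Simulation M M′ B
total⇒±simulation b = record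
  { atoms = atoms b
  ; forth = λ r A v e → let (v′ , q) = total b v in
      v′ , (λ a → e a ⇔-∘ ⇔-sym (reach b r q a)) , q
  ; reach = reach b
  }

total⇒⇌ : ∀ {B} → IsTotalBisimulation M M′ B → M ⇌ M′
total⇒⇌ {B = B} b =
  (λ w → map id (λ r → B , bisim , r) (total b w)) ,
  (λ w′ → map id (λ r → B , bisim , r) (surjective b w′))
  where bisim = total⇒±simulation b , total⇒±simulation (isTotalBisimulation-sym b)

-- Serves the `C` case, where the partner of the endpoint may be chosen; this makes an empty `A`
-- harmless, in contrast to `Rᶜ-map`.
Rᶜ-lift : ∀ {B} → IsTotalBisimulation M M′ B → ∀ A {w v w′} → B w w′ →
          Rᶜ M A w v → ∃ λ v′ → B v v′ × Rᶜ M′ A w′ v′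
Rᶜ-lift b A r ε = _ , r , ε
Rᶜ-lift b A r (_◅_ {j = u} (a , a∈A , s) p) =
  let (u′ , q)      = total b u
      (v′ , t , p′) = Rᶜ-lift b A q p
  in v′ , t , (a , a∈A , to (reach b r q a) s) ◅ p′

-- For empty A this fails: Rᶜ is then equality, which B need not reflect.
Rᶜ-map : ∀ {B} → IsReflexive M → IsTotalBisimulation M M′ B →
         ∀ {A a} → a ∈ A → ∀ {w w′ v v′} → B w w′ → B v v′ →
         Rᶜ M A w v → Rᶜ M′ A w′ v′
-- Here `w` and `v` coincide while `w′` and `v′` may differ: the loop of `a` at `w` transfers to an
-- edge from `w′` to `v′`.
Rᶜ-map rf b {a = a} a∈A r q ε = (a , a∈A , to (reach b r q a) (rf a)) ◅ ε
Rᶜ-map rf b a∈A r q (_◅_ {j = u} (c , c∈A , s) p) =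
  let (u′ , t) = total b u in
  (c , c∈A , to (reach b r t c) s) ◅ Rᶜ-map rf b a∈A t q p

-- On the diagonal, what a case demands of the target is what it assumes of the source, so nothing
-- has to be decided.
refine-isReflexive : (M : Structure n AP ℓ) → IsReflexive M → ∀ A Z P →
                     IsReflexive (refine M A Z P)
refine-isReflexive M rf A Z P a = record
  { outside   = λ _ → rf a
  ; positive  = λ { _ (_ , p) → rf a , p }
  ; negative  = λ { _ (_ , ¬p) → rf a , ¬p }
  ; otherwise = λ _ _ _ → rf a
  }

Invariant : {W W′ : Set ℓ} → REL W W′ ℓ → Pred W ℓ → Pred W′ ℓ → Set ℓ
Invariant B P P′ = ∀ {w w′} → B w w′ → P w ⇔ P′ w′

module _ {M M′ : Structure n AP ℓ}
         {B : REL (W M) (W M′) ℓ} {A : Subset n}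
         {Z : Fin n → Pred (W M) ℓ} {Z′ : Fin n → Pred (W M′) ℓ}
         {P : Pred (W M) ℓ} {P′ : Pred (W M′) ℓ} where

  -- Case conditions are pulled back along `B` and their conclusions pushed forward. Invariance of
  -- `Z` is asked under `a ∈ A`, which supplies the member of `A` that `Rᶜ-map` requires.
  RefinedR-map : IsTotalBisimulation M M′ B →
                 (∀ {a} → a ∈ A → Invariant B (Z a) (Z′ a)) → Invariant B P P′ →
                 ∀ {w w′} → B w w′ → ∀ {v v′} → B v v′ → ∀ {a} →
                 RefinedR M A Z P a w v → RefinedR M′ A Z′ P′ a w′ v′
  RefinedR-map b z p r q {a} s = record
    { outside   = λ a∉A → fwd (outside a∉A)
    ; positive  = λ { a∈A (x , y) →
        map fwd (to (p q)) (positive a∈A (from (z a∈A r) x , from (p r) y)) }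
    ; negative  = λ { a∈A (x , y) →
        map fwd (λ ¬y x′ → ¬y (from (p q) x′))
            (negative a∈A (from (z a∈A r) x , λ y′ → y (to (p r) y′))) }
    ; otherwise = λ a∈A ¬pos ¬neg → fwd (otherwise a∈A
        (λ { (x , y) → ¬pos (to (z a∈A r) x , to (p r) y) })
        (λ { (x , y) → ¬neg (to (z a∈A r) x , λ y′ → y (from (p r) y′)) }))
    }
    where
    open RefinedR s
    fwd = to (reach b r q a)

refine-total : ∀ {B A Z Z′ P P′} → IsTotalBisimulation M M′ B →
               (∀ {a} → a ∈ A → Invariant B (Z a) (Z′ a)) → Invariant B P P′ →
               IsTotalBisimulation (refine M A Z P) (refine M′ A Z′ P′) B
refine-total {M = M} {M′} b z p = record
  { atoms      = atoms b
  ; total      = total b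
  ; surjective = surjective b
  ; reach      = λ r q a → mk⇔
      (RefinedR-map {M = M} {M′} b z p r q)
      (RefinedR-map {M = M′} {M} (isTotalBisimulation-sym b)
        (λ a∈A t → ⇔-sym (z a∈A t)) (λ t → ⇔-sym (p t)) r q)
  }

refine⁻-total : ∀ {B P P′ s s′} → IsTotalBisimulation M M′ B → B s s′ →
                Invariant B P P′ → ∀ A →
                IsTotalBisimulation (refine⁻ M s P A) (refine⁻ M′ s′ P′ A) B
-- Invariance of the class of `s` under `a` is `reach` at the pair `r`.
refine⁻-total b r p A = refine-total b (λ {a} _ q → reach b r q a) p

refine⁺-total : ∀ {B P P′ s s′} → IsReflexive M → IsReflexive M′ →
                IsTotalBisimulation M M′ B → B s s′ → Invariant B P P′ → ∀ A →
                IsTotalBisimulation (refine⁺ M s P A) (refine⁺ M′ s′ P′ A) B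
refine⁺-total rf rf′ b r p A = refine-total b
  (λ a∈A q → mk⇔ (Rᶜ-map rf b a∈A r q)
                 (Rᶜ-map rf′ (isTotalBisimulation-sym b) a∈A r q)) p

mutual
  -- One direction suffices, the premises being symmetric under `flip B`. Negation and announcements
  -- use both directions for a smaller formula, hence the mutual recursion.
  ⟦⟧-map : ∀ (ψ : Formula n AP) {M M′ : Structure n AP ℓ} {B} →
           IsReflexive M → IsReflexive M′ → IsTotalBisimulation M M′ B →
           ∀ {w w′} → B w w′ → ⟦ ψ ⟧ M w → ⟦ ψ ⟧ M′ w′
  ⟦⟧-map (atom p) rf rf′ b r = to (atoms b r p)
  ⟦⟧-map (¬′ ψ) rf rf′ b r ¬x x = ¬x (from (⟦⟧-invariant ψ rf rf′ b r) x)
  ⟦⟧-map (ψ ∧′ χ) rf rf′ b r = map (⟦⟧-map ψ rf rf′ b r) (⟦⟧-map χ rf rf′ b r)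
  ⟦⟧-map (C A ψ) rf rf′ b r f v′ p′ =
    let (v , q , p) = Rᶜ-lift (isTotalBisimulation-sym b) A r p′ in
    ⟦⟧-map ψ rf rf′ b q (f v p)
  ⟦⟧-map ([ ψ ]⁺ A · χ) {M} {M′} rf rf′ b r f x =
    -- Invariance of `ψ` is taken at all related pairs, since its truth at every world shapes the
    -- refinement.
    let i = ⟦⟧-invariant ψ rf rf′ b in
    ⟦⟧-map χ (refine-isReflexive M rf A _ _) (refine-isReflexive M′ rf′ A _ _)
      (refine⁺-total rf rf′ b r i A) r (f (from (i r) x))
  ⟦⟧-map ([ ψ ]⁻ A · χ) {M} {M′} rf rf′ b r f x =
    let i = ⟦⟧-invariant ψ rf rf′ b in
    ⟦⟧-map χ (refine-isReflexive M rf A _ _) (refine-isReflexive M′ rf′ A _ _)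
      (refine⁻-total b r i A) r (f (from (i r) x))

  ⟦⟧-invariant : ∀ (ψ : Formula n AP) {M M′ : Structure n AP ℓ} {B} →
                 IsReflexive M → IsReflexive M′ → IsTotalBisimulation M M′ B →
                 Invariant B (⟦ ψ ⟧ M) (⟦ ψ ⟧ M′)
  ⟦⟧-invariant ψ rf rf′ b r = mk⇔
    (⟦⟧-map ψ rf rf′ b r)
    (⟦⟧-map ψ rf′ rf (isTotalBisimulation-sym b) r)

theorem8 : ∀ {ℓ : Level} {n : ℕ} {AP : Set} (M M′ : Structure n AP ℓ) →
    IsModel M → IsModel M′ →
    (s : W M) (s′ : W M′) → M , s ⇌ M′ , s′ →
    (∀ (ψ : Formula n AP) → (M , s ⊨ ψ) ⇔ (M′ , s′ ⊨ ψ)) ×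
    (∀ (θ : Formula n AP) (A : Subset n) → M ⁻⟨ s , θ , A ⟩ ⇌ M′ ⁻⟨ s′ , θ , A ⟩) ×
    (∀ (θ : Formula n AP) (A : Subset n) → M ⁺⟨ s , θ , A ⟩ ⇌ M′ ⁺⟨ s′ , θ , A ⟩)
theorem8 M M′ eq eq′ s s′ (_ , B , bisim , r) =
  (λ ψ → inv ψ r) ,
  (λ θ A → total⇒⇌ (refine⁻-total b r (inv θ) A)) ,
  (λ θ A → total⇒⇌ (refine⁺-total rf rf′ b r (inv θ) A))
  where
  b   = ±bisimulation⇒total bisim r
  rf  : IsReflexive M
  rf a = IsEquivalence.refl (eq a)
  rf′ : IsReflexive M′
  rf′ a = IsEquivalence.refl (eq′ a)
  inv : ∀ ψ → Invariant B (⟦ ψ ⟧ M) (⟦ ψ ⟧ M′)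
  inv ψ = ⟦⟧-invariant ψ rf rf′ b
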